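{- Let $\mathsf L$ be an intermediate logic with $\mathsf L\subseteq\mathsf L(\mathfrak R_2)$ which has unitary unification. Then there is an $\mathsf L$-unifiable formula $A\in\mathsf{Fm}^n$ (for some $n$) such that all its most general unifiers introduce new variables, i.e. $A$ has no most general unifier of the form $\varepsilon:\{x_1,\dots,x_n\}\to\mathsf{Fm}^n$.
   Context: Formulas are built from variables $x_1,x_2,\dots$ with $\to,\lor,\land,\bot$; $\mathsf{Fm}^n$ is the set of formulas in $x_1,\dots,x_n$. An intermediate logic is a set of formulas containing $\mathsf{INT}$, closed under modus ponens and substitution. A frame is a finite partially ordered set with a least element (root); $\mathsf L(\mathfrak F)$ is the set of formulas valid in every intuitionistic Kripke model over the frame $\mathfrak F$. $\mathfrak R_2$ is the four-element rhombus frame: root $r$, two incomparable elements $a,b$ above $r$, and a top element $t$ above $a$ and $b$. A substitution $\sigma:\{x_1,\dots,x_n\}\to\mathsf{Fm}^k$ is an $\mathsf L$-unifier of $A$ if $\sigma(A)\in\mathsf L$; $\varepsilon\preccurlyeq\mu$ iff $\alpha\circ\varepsilon$ and $\mu$ are $\mathsf L$-equivalent (on all formulas) for some substitution $\alpha$. A most general unifier (mgu) of $A$ is a unifier $\varepsilon$ with $\varepsilon\preccurlyeq\mu$ for all unifiers $\mu$ of $A$. Unification in $\mathsf L$ is unitary if every unifiable formula has an mgu. No local tabularity of $\mathsf L$ is assumed. -}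

module Defs where

open import Data.Nat using (ℕ; _<_)
open import Data.Product using (Σ; _×_; _,_)
open import Data.Sum using (_⊎_)
open import Data.Bool using (Bool; true)
open import Data.Empty using (⊥)
open import Data.Unit using (⊤)
open import Relation.Binary.PropositionalEquality using (_≡_)

-- Formulas.  Variable x_{i+1} is  var i  (so x_1 = var 0).

infixr 5 _⇒_
infixr 6 _∨′_
infixr 7 _∧′_

data Fm : Set where
  var  : ℕ → Fm
  _⇒_  : Fm → Fm → Fm
  _∨′_ : Fm → Fm → Fm
  _∧′_ : Fm → Fm → Fm
  ⊥′   : Fm

_⇔_ : Fm → Fm → Fm
A ⇔ B = (A ⇒ B) ∧′ (B ⇒ A)

InFm : ℕ → Fm → Set
InFm n (var i)  = i < n
InFm n (A ⇒ B)  = InFm n A × InFm n B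
InFm n (A ∨′ B) = InFm n A × InFm n B
InFm n (A ∧′ B) = InFm n A × InFm n B
InFm n ⊥′       = ⊤

sub : (ℕ → Fm) → Fm → Fm
sub σ (var i)  = σ i
sub σ (A ⇒ B)  = sub σ A ⇒ sub σ B
sub σ (A ∨′ B) = sub σ A ∨′ sub σ B
sub σ (A ∧′ B) = sub σ A ∧′ sub σ B
sub σ ⊥′       = ⊥′

-- a substitution σ : {x_1,…,x_n} → Fm^k
-- (values on variables outside x_1..x_n are irrelevant: it is only ever
--  applied to formulas of Fm^n)
record Sub (n k : ℕ) : Set where
  constructor mkSub
  field
    map : ℕ → Fm
    ok  : ∀ i → i < n → InFm k (map i)
open Sub public

apply : ∀ {n k} → Sub n k → Fm → Fm
apply σ = sub (map σ)

Logic : Set₁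
Logic = Fm → Set

data IntAxiom : Fm → Set where
  ax-K   : ∀ A B → IntAxiom (A ⇒ (B ⇒ A))
  ax-S   : ∀ A B C → IntAxiom ((A ⇒ (B ⇒ C)) ⇒ ((A ⇒ B) ⇒ (A ⇒ C)))
  ax-∧₁  : ∀ A B → IntAxiom ((A ∧′ B) ⇒ A)
  ax-∧₂  : ∀ A B → IntAxiom ((A ∧′ B) ⇒ B)
  ax-∧I  : ∀ A B → IntAxiom (A ⇒ (B ⇒ (A ∧′ B)))
  ax-∨₁  : ∀ A B → IntAxiom (A ⇒ (A ∨′ B))
  ax-∨₂  : ∀ A B → IntAxiom (B ⇒ (A ∨′ B))
  ax-∨E  : ∀ A B C → IntAxiom ((A ⇒ C) ⇒ ((B ⇒ C) ⇒ ((A ∨′ B) ⇒ C)))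
  ax-⊥   : ∀ A → IntAxiom (⊥′ ⇒ A)

-- INT is the least set containing IntAxiom closed under MP (and substitution,
-- which is admissible since the axioms are schemes)
data INT : Fm → Set where
  axiom : ∀ {A} → IntAxiom A → INT A
  mp    : ∀ {A B} → INT (A ⇒ B) → INT A → INT B

record IntermediateLogic (L : Logic) : Set where
  field
    containsINT : ∀ A → INT A → L A
    closedMP    : ∀ A B → L (A ⇒ B) → L A → L B
    closedSub   : ∀ (σ : ℕ → Fm) A → L A → L (sub σ A)

module Kripke (W : Set) (_≤_ : W → W → Set) where

  Valuation : Set
  Valuation = ℕ → W → Bool

  Monotone : Valuation → Set
  Monotone V = ∀ i w v → w ≤ v → V i w ≡ true → V i v ≡ true

  Forces : Valuation → W → Fm → Set
  Forces V w (var i)  = V i w ≡ true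
  Forces V w (A ⇒ B)  = ∀ v → w ≤ v → Forces V v A → Forces V v B
  Forces V w (A ∨′ B) = Forces V w A ⊎ Forces V w B
  Forces V w (A ∧′ B) = Forces V w A × Forces V w B
  Forces V w ⊥′       = ⊥

  LFrame : Logic
  LFrame A = ∀ (V : Valuation) → Monotone V → ∀ w → Forces V w A

data R2 : Set where
  r a b t : R2

data _≤R2_ : R2 → R2 → Set where
  refl≤ : ∀ {w} → w ≤R2 w
  r≤a : r ≤R2 a
  r≤b : r ≤R2 b
  r≤t : r ≤R2 t
  a≤t : a ≤R2 t
  b≤t : b ≤R2 t

L-R2 : Logic
L-R2 = Kripke.LFrame R2 _≤R2_

module Unification (L : Logic) where

  Unifier : ∀ {n k} → Fm → Sub n k → Set
  Unifier A σ = L (apply σ A)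

  Unifiable : ℕ → Fm → Set
  Unifiable n A = Σ ℕ λ k → Σ (Sub n k) λ σ → Unifier A σ

  _≼_ : ∀ {n k m} → Sub n k → Sub n m → Set
  _≼_ {n} {k} ε μ =
    Σ ℕ λ j → Σ (Sub k j) λ α →
      ∀ B → InFm n B → L (apply α (apply ε B) ⇔ apply μ B)

  MGU : ∀ {n k} → Fm → Sub n k → Set
  MGU {n} A ε = Unifier A ε × (∀ m (μ : Sub n m) → Unifier A μ → ε ≼ μ)

  Unitary : Set
  Unitary = ∀ n A → InFm n A → Unifiable n A →
            Σ ℕ λ k → Σ (Sub n k) λ ε → MGU A ε

{-# OPTIONS --safe #-}
-- For each i, the substitution μᵢ sending xᵢ to ⊤ and fixing the other variables
-- unifies x₁ ∨ x₂ ∨ x₃.  Suppose ε : {x₁,x₂,x₃} → Fm³ is an mgu.  Factoring μᵢ through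
-- ε turns every model on R₂ into one in which ε(x_k) is forced exactly where μᵢ(x_k)
-- was forced in the original.  Apply this to the model Wⱼ in which x_k holds only at t,
-- and only if k ≠ j; let V be the result for the pair (i , j).
-- The restriction of V to t determines i: if V and V′ agree at t but i ≠ i′, glue the
-- a-point of V to the b-point of V′.  No ε(x_k) is forced at both, so none is
-- forced at the root, contradicting that ε is a unifier.  It also determines
-- which ε(x_k) hold at t, hence j.  So 3 · 3 pairs (i , j) inject into the 2³
-- classical valuations of three variables.
module Submission where

open import Defs
open import Data.Bool using (Bool; true; false; not; _∨_)
import Data.Bool as Bool
open import Data.Bool.Properties using (∨-idem; ∨-zeroʳ)
open import Data.Empty using (⊥)
open import Data.Fin using (Fin; zero; suc; #_; toℕ; fromℕ<; funToFin; finToFun; remQuot; combine)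
open import Data.Fin.Properties
  using (2↔Bool; finToFun-funToFin; combine-remQuot; <⇒notInjective; toℕ<n; toℕ-injective;
         toℕ-fromℕ<)
  renaming (_≟_ to _≟ᶠ_)
open import Data.Nat using (ℕ; _<_; _≟_)
open import Data.Nat.Properties using (n<1+n)
open import Data.Product as Prod using (Σ; _×_; _,_; proj₁; proj₂; uncurry)
open import Data.Sum as Sum using (_⊎_; inj₁; inj₂)
open import Data.Unit using (tt)
open import Function using (_∘_; Inverse; Equivalence; mk⇔) renaming (_⇔_ to _iff_)
open import Relation.Nullary
  using (¬_; Dec; yes; no; does; map′; ¬?; contradiction; _×-dec_; _⊎-dec_; _→-dec_)
open import Relation.Binary.Definitions using (Reflexive; Transitive; Decidable)
open import Relation.Binary.PropositionalEquality
  using (_≡_; _≢_; _≗_; refl; sym; trans; cong; subst; module ≡-Reasoning)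

open Equivalence using (to; from)

true⇔ : ∀ {P : Set} (P? : Dec P) → does P? ≡ true iff P
true⇔ (yes p) = mk⇔ (λ _ → p) (λ _ → refl)
true⇔ (no ¬p) = mk⇔ (λ ()) (λ p → contradiction p ¬p)

-- Locality of forcing, and pulling models back along substitutions.

module Model {W : Set} {_≤_ : W → W → Set} (≤-trans : Transitive _≤_) where
  open Kripke W _≤_

  persistent : ∀ {V} → Monotone V → ∀ A {w v} → w ≤ v → Forces V w A → Forces V v A
  persistent mon (var i)  w≤v f = mon i _ _ w≤v f
  persistent mon (A ⇒ B)  w≤v f u v≤u = f u (≤-trans w≤v v≤u)
  persistent mon (A ∨′ B) w≤v =
    Sum.map (persistent mon A w≤v) (persistent mon B w≤v)
  persistent mon (A ∧′ B) w≤v =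
    Prod.map (persistent mon A w≤v) (persistent mon B w≤v)

  AgreeFrom : ℕ → W → Valuation → Valuation → Set
  AgreeFrom n w U V = ∀ i v → i < n → w ≤ v → U i v ≡ V i v

  -- Forcing only looks upwards. This carries forcing between a glued model and its two pieces, and
  -- between models that agree at `t`.
  forces-local : Reflexive _≤_ → ∀ {n U V} A {w} → InFm n A → AgreeFrom n w U V →
                 Forces U w A → Forces V w A
  forces-local ≤-refl (var i) i<n eq f = trans (sym (eq i _ i<n ≤-refl)) f
  forces-local ≤-refl (A ⇒ B) (p , q) eq f v w≤v g =
    forces-local ≤-refl B q eqᵛ
      (f v w≤v (forces-local ≤-refl A p (λ i u i<n v≤u → sym (eqᵛ i u i<n v≤u)) g))
    where eqᵛ = λ i u i<n v≤u → eq i u i<n (≤-trans w≤v v≤u)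
  forces-local ≤-refl (A ∨′ B) (p , q) eq =
    Sum.map (forces-local ≤-refl A p eq) (forces-local ≤-refl B q eq)
  forces-local ≤-refl (A ∧′ B) (p , q) eq =
    Prod.map (forces-local ≤-refl A p eq) (forces-local ≤-refl B q eq)

  module Pullback (forces? : ∀ V w A → Dec (Forces V w A)) where

    -- Valuations are Boolean, so treating `σ i` as a variable takes a decision procedure for
    -- forcing.
    pullback : (ℕ → Fm) → Valuation → Valuation
    pullback σ V i w = does (forces? V w (σ i))

    pullback-monotone : ∀ σ {V} → Monotone V → Monotone (pullback σ V)
    pullback-monotone σ {V} mon i w v w≤v f =
      from (true⇔ (forces? V v (σ i)))
        (persistent mon (σ i) w≤v (to (true⇔ (forces? V w (σ i))) f))

    forces-sub : ∀ σ {V} A {w} → Forces (pullback σ V) w A iff Forces V w (sub σ A)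
    forces-sub σ {V} (var i) {w} = true⇔ (forces? V w (σ i))
    forces-sub σ (A ⇒ B) = mk⇔
      (λ f v w≤v g → to (forces-sub σ B) (f v w≤v (from (forces-sub σ A) g)))
      (λ f v w≤v g → from (forces-sub σ B) (f v w≤v (to (forces-sub σ A) g)))
    forces-sub σ (A ∨′ B) = mk⇔
      (Sum.map (to (forces-sub σ A)) (to (forces-sub σ B)))
      (Sum.map (from (forces-sub σ A)) (from (forces-sub σ B)))
    forces-sub σ (A ∧′ B) = mk⇔
      (Prod.map (to (forces-sub σ A)) (to (forces-sub σ B)))
      (Prod.map (from (forces-sub σ A)) (from (forces-sub σ B)))
    forces-sub σ ⊥′ = mk⇔ (λ ()) (λ ())

-- The rhombus: decidable forcing and gluing.

≤R2-trans : Transitive _≤R2_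
≤R2-trans refl≤ q     = q
≤R2-trans r≤a   refl≤ = r≤a
≤R2-trans r≤a   a≤t   = r≤t
≤R2-trans r≤b   refl≤ = r≤b
≤R2-trans r≤b   b≤t   = r≤t
≤R2-trans r≤t   refl≤ = r≤t
≤R2-trans a≤t   refl≤ = a≤t
≤R2-trans b≤t   refl≤ = b≤t

r≤ : ∀ w → r ≤R2 w
r≤ r = refl≤
r≤ a = r≤a
r≤ b = r≤b
r≤ t = r≤t

_≤R2?_ : Decidable _≤R2_
r ≤R2? w = yes (r≤ w)
a ≤R2? r = no λ ()
a ≤R2? a = yes refl≤
a ≤R2? b = no λ ()
a ≤R2? t = yes a≤t
b ≤R2? r = no λ ()
b ≤R2? a = no λ ()
b ≤R2? b = yes refl≤
b ≤R2? t = yes b≤t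
t ≤R2? r = no λ ()
t ≤R2? a = no λ ()
t ≤R2? b = no λ ()
t ≤R2? t = yes refl≤

allR2? : {P : R2 → Set} → (∀ w → Dec (P w)) → Dec (∀ w → P w)
allR2? P? = map′
  (λ { (pr , pa , pb , pt) → λ { r → pr ; a → pa ; b → pb ; t → pt } })
  (λ p → p r , p a , p b , p t)
  (P? r ×-dec P? a ×-dec P? b ×-dec P? t)

open Kripke R2 _≤R2_

forces? : ∀ V w A → Dec (Forces V w A)
forces? V w (var i)  = V i w Bool.≟ true
forces? V w (A ⇒ B)  =
  allR2? λ v → (w ≤R2? v) →-dec forces? V v A →-dec forces? V v B
forces? V w (A ∨′ B) = forces? V w A ⊎-dec forces? V w B
forces? V w (A ∧′ B) = forces? V w A ×-dec forces? V w B
forces? V w ⊥′       = no λ ()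

open Model {_≤_ = _≤R2_} ≤R2-trans
open Pullback forces?

-- The disjunction at t matters only for variables on which U and V differ there;
-- it keeps the valuation monotone.
glue : Valuation → Valuation → Valuation
glue U V i r = false
glue U V i a = U i a
glue U V i b = V i b
glue U V i t = U i t ∨ V i t

glue-monotone : ∀ {U V} → Monotone U → Monotone V → Monotone (glue U V)
glue-monotone mU mV i w w refl≤ f = f
glue-monotone {U} {V} mU mV i a t a≤t f = cong (_∨ V i t) (mU i a t a≤t f)
glue-monotone {U} {V} mU mV i b t b≤t f =
  trans (cong (U i t ∨_) (mV i b t b≤t f)) (∨-zeroʳ (U i t))

module _ {n : ℕ} {U V : Valuation} (U≗V : ∀ i → i < n → U i t ≡ V i t) where

  -- Only `a` and `t` lie above `a`, and at `t` the disjunction of two equal values collapses.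
  glue-agrees-a : AgreeFrom n a (glue U V) U
  glue-agrees-a i a i<n refl≤ = refl
  glue-agrees-a i t i<n a≤t   = trans (cong (U i t ∨_) (sym (U≗V i i<n))) (∨-idem (U i t))

  glue-agrees-b : AgreeFrom n b (glue U V) V
  glue-agrees-b i b i<n refl≤ = refl
  glue-agrees-b i t i<n b≤t   = trans (cong (_∨ V i t) (U≗V i i<n)) (∨-idem (V i t))

  agree-t : AgreeFrom n t U V
  agree-t i t i<n refl≤ = U≗V i i<n

-- The unifiers of the disjunction and the test models.

⊤′ : Fm
⊤′ = ⊥′ ⇒ ⊥′

set⊤ : ℕ → ℕ → Fm
set⊤ i k with k ≟ i
... | yes _ = ⊤′
... | no _  = var k

set⊤-∈Fm : ∀ {n} i k → k < n → InFm n (set⊤ i k)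
set⊤-∈Fm i k k<n with k ≟ i
... | yes _ = tt , tt
... | no _  = k<n

-- Falsity below `t` exposes `i` there; the gap at `t` exposes `j`.
topExcept : ℕ → Valuation
topExcept j k t = not (does (k ≟ j))
topExcept j k _ = false

topExcept-monotone : ∀ j → Monotone (topExcept j)
topExcept-monotone j k t t refl≤ f = f

forces-below-t : ∀ {i j k} w → w ≢ t → Forces (topExcept j) w (set⊤ i k) → k ≡ i
forces-below-t {i} {j} {k} w w≢t f with k ≟ i
forces-below-t w w≢t f  | yes k≡i = k≡i
forces-below-t t w≢t f  | no _    = contradiction refl w≢t
forces-below-t r w≢t () | no _
forces-below-t a w≢t () | no _
forces-below-t b w≢t () | no _

-- For fixed `i`, the indices failing at `t` form the set {j} minus {i}, which differs for different
-- `j`.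
forces-at-t : ∀ {i j k} → Forces (topExcept j) t (set⊤ i k) iff (k ≡ i ⊎ k ≢ j)
forces-at-t {i} {j} {k} with k ≟ i
... | yes k≡i = mk⇔ (λ _ → inj₁ k≡i) (λ _ _ _ f → f)
... | no k≢i  = mk⇔
  (inj₂ ∘ to (true⇔ (¬? (k ≟ j))))
  (from (true⇔ (¬? (k ≟ j))) ∘ Sum.fromInj₂ (λ k≡i → contradiction k≡i k≢i))

-- Three disjuncts, because n² > 2ⁿ holds only for n = 3.
A₃ : Fm
A₃ = var 0 ∨′ var 1 ∨′ var 2

A₃-∈Fm : InFm 3 A₃
A₃-∈Fm = toℕ<n {3} (# 0) , toℕ<n {3} (# 1) , toℕ<n {3} (# 2)

forces-A₃ : ∀ σ {V w} → Forces V w (sub σ A₃) → Σ (Fin 3) λ k → Forces V w (σ (toℕ k))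
forces-A₃ σ (inj₁ f)        = # 0 , f
forces-A₃ σ (inj₂ (inj₁ f)) = # 1 , f
forces-A₃ σ (inj₂ (inj₂ f)) = # 2 , f

μ : Fin 3 → Sub 3 3
μ i = mkSub (set⊤ (toℕ i)) (set⊤-∈Fm (toℕ i))

INT-μ : ∀ i → INT (apply (μ i) A₃)
INT-μ zero             = mp (axiom (ax-∨₁ _ _)) (axiom (ax-⊥ _))
INT-μ (suc zero)       =
  mp (axiom (ax-∨₂ _ _)) (mp (axiom (ax-∨₁ _ _)) (axiom (ax-⊥ _)))
INT-μ (suc (suc zero)) =
  mp (axiom (ax-∨₂ _ _)) (mp (axiom (ax-∨₂ _ _)) (axiom (ax-⊥ _)))

encode : (Fin 3 → Bool) → Fin 8
encode f = funToFin (Inverse.from 2↔Bool ∘ f)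

-- Pointwise equality suffices below and avoids function extensionality.
encode-injective : ∀ f g → encode f ≡ encode g → f ≗ g
encode-injective f g eq k = begin
  f k                                       ≡⟨ decode f ⟨
  Inverse.to 2↔Bool (finToFun (encode f) k) ≡⟨ cong (λ c → Inverse.to 2↔Bool (finToFun c k)) eq ⟩
  Inverse.to 2↔Bool (finToFun (encode g) k) ≡⟨ decode g ⟩
  g k                                       ∎
  where
  open ≡-Reasoning
  decode : ∀ h → Inverse.to 2↔Bool (finToFun (encode h) k) ≡ h k
  decode h = trans (cong (Inverse.to 2↔Bool) (finToFun-funToFin (Inverse.from 2↔Bool ∘ h) k))
                   (Inverse.strictlyInverseˡ 2↔Bool (h k))

-- Refuting an mgu in three variables.

module _ (L : Logic) (int : IntermediateLogic L) (L⊆R2 : ∀ A → L A → L-R2 A) where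
  open IntermediateLogic int
  open Unification L

  unifier-μ : ∀ i → Unifier A₃ (μ i)
  unifier-μ i = containsINT _ (INT-μ i)

  module _ (ε : Sub 3 3) (mgu : MGU A₃ ε) where

    α : Fin 3 → ℕ → Fm
    α i = map (proj₁ (proj₂ (proj₂ mgu 3 (μ i) (unifier-μ i))))

    model : Fin 3 → Fin 3 → Valuation
    model i j = pullback (α i) (topExcept (toℕ j))

    model-monotone : ∀ i j → Monotone (model i j)
    model-monotone i j = pullback-monotone (α i) (topExcept-monotone (toℕ j))

    -- Pulling back turns `ε` of a variable into `α i` applied to it, which is `L`-equivalent to its
    -- image under `μ i`; that equivalence is valid on the rhombus.
    forces-model : ∀ i j k {w} → Forces (model i j) w (map ε (toℕ k)) iff
                                 Forces (topExcept (toℕ j)) w (set⊤ (toℕ i) (toℕ k))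
    forces-model i j k {w} = mk⇔
      (λ f → proj₁ αε⇔μ w refl≤ (to (forces-sub (α i) (map ε (toℕ k))) f))
      (λ f → from (forces-sub (α i) (map ε (toℕ k))) (proj₂ αε⇔μ w refl≤ f))
      where
      αε⇔μ : Forces (topExcept (toℕ j)) w
               (sub (α i) (map ε (toℕ k)) ⇔ set⊤ (toℕ i) (toℕ k))
      αε⇔μ = L⊆R2 _ (proj₂ (proj₂ (proj₂ mgu 3 (μ i) (unifier-μ i))) (var (toℕ k)) (toℕ<n k))
               (topExcept (toℕ j)) (topExcept-monotone (toℕ j)) w

    AgreeAtT : (i j i′ j′ : Fin 3) → Set
    AgreeAtT i j i′ j′ = ∀ p → p < 3 → model i j p t ≡ model i′ j′ p t

    determines-i : ∀ i j i′ j′ → AgreeAtT i j i′ j′ → i ≡ i′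
    determines-i i j i′ j′ eq = toℕ-injective (trans (sym k≡i) k≡i′)
      where
      U = glue (model i j) (model i′ j′)
      mU = glue-monotone (model-monotone i j) (model-monotone i′ j′)
      -- A disjunction forced at `r` yields one disjunct forced there, so the same `k` persists to
      -- both `a` and `b`.
      root : Σ (Fin 3) λ k → Forces U r (map ε (toℕ k))
      root = forces-A₃ (map ε) (L⊆R2 _ (proj₁ mgu) U mU r)
      k = proj₁ root
      εk = map ε (toℕ k)
      εk∈Fm : InFm 3 εk
      εk∈Fm = ok ε (toℕ k) (toℕ<n k)
      k≡i : toℕ k ≡ toℕ i
      k≡i = forces-below-t a (λ ()) (to (forces-model i j k)
        (forces-local refl≤ εk εk∈Fm (glue-agrees-a eq) (persistent mU εk r≤a (proj₂ root))))
      k≡i′ : toℕ k ≡ toℕ i′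
      k≡i′ = forces-below-t b (λ ()) (to (forces-model i′ j′ k)
        (forces-local refl≤ εk εk∈Fm (glue-agrees-b eq) (persistent mU εk r≤b (proj₂ root))))

    -- The image of variable `j′` holds at `t` for `(i , j)`, hence by agreement for `(i , j′)`,
    -- where `j′` is the gap; only being sent to `⊤′` explains that.
    false-at-t : ∀ i j j′ → AgreeAtT i j i j′ → j ≢ j′ → j′ ≡ i
    false-at-t i j j′ eq j≢j′ =
      Sum.[ toℕ-injective , contradiction refl ] (to forces-at-t (to (forces-model i j′ j′)
        (forces-local refl≤ (map ε (toℕ j′)) (ok ε (toℕ j′) (toℕ<n j′)) (agree-t eq)
          (from (forces-model i j j′) (from forces-at-t (inj₂ (j≢j′ ∘ sym ∘ toℕ-injective)))))))

    determines-j : ∀ i j j′ → AgreeAtT i j i j′ → j ≡ j′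
    determines-j i j j′ eq with j ≟ᶠ j′
    ... | yes j≡j′ = j≡j′
    -- By symmetry both `j` and `j′` would equal `i`.
    ... | no j≢j′  = trans (false-at-t i j′ j (λ p p<3 → sym (eq p p<3)) (j≢j′ ∘ sym))
                           (sym (false-at-t i j j′ eq j≢j′))

    colour : Fin 3 → Fin 3 → Fin 3 → Bool
    colour i j p = model i j (toℕ p) t

    atT : Fin 3 × Fin 3 → Fin 8
    atT (i , j) = encode (colour i j)

    atT-injective : ∀ {x y} → atT x ≡ atT y → x ≡ y
    atT-injective {i , j} {i′ , j′} eq = lemma agree
      where
      agree : AgreeAtT i j i′ j′
      agree p p<3 = subst (λ q → model i j q t ≡ model i′ j′ q t) (toℕ-fromℕ< p<3)
                      (encode-injective (colour i j) (colour i′ j′) eq (fromℕ< p<3))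
      lemma : AgreeAtT i j i′ j′ → (i , j) ≡ (i′ , j′)
      -- `i` and `i′` are identified first, since `determines-j` compares models with a common `i`.
      lemma ag with refl ← determines-i i j i′ j′ ag = cong (i ,_) (determines-j i j j′ ag)

    no-mgu : ⊥
    -- `remQuot` lists the nine pairs as `Fin 9`, one more than the eight codes.
    no-mgu = <⇒notInjective {f = atT ∘ remQuot {3} 3} (n<1+n 8) λ {x} {y} eq → begin
      x                                 ≡⟨ combine-remQuot {3} 3 x ⟨
      uncurry combine (remQuot {3} 3 x) ≡⟨ cong (uncurry combine) (atT-injective eq) ⟩
      uncurry combine (remQuot {3} 3 y) ≡⟨ combine-remQuot {3} 3 y ⟩
      y                                 ∎
      where open ≡-Reasoning

theorem5p1 : (L : Logic) → IntermediateLogic L → (∀ A → L A → L-R2 A) →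
    Unification.Unitary L →
    Σ ℕ λ n → Σ Fm λ A → InFm n A × Unification.Unifiable L n A ×
    (∀ (ε : Sub n n) → ¬ Unification.MGU L A ε)
theorem5p1 L int L⊆R2 _ =
  3 , A₃ , A₃-∈Fm , (3 , μ zero , unifier-μ L int L⊆R2 zero) , no-mgu L int L⊆R2
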